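{- Let $s_Z$ be the Zeckendorf sum of digits function. Let $I_Z=(I_Z(n))_{n\ge1}$ be the increasing enumeration of the points of increase of $s_Z$, $C_Z=(C_Z(n))_{n\ge1}$ the increasing enumeration of the points of constancy of $s_Z$, and $D_Z=(D_Z(n))_{n\ge1}$ the sequence with $D_Z(1)=-1$ and $D_Z(n+1)$ equal to the $n$-th smallest point of decrease of $s_Z$ ($n\ge1$). Then: (i) $I_Z(1)=0$, and the sequence $\Delta I_Z$ is the fixed point of the morphism $3\mapsto 32,\ 2\mapsto 3$ (on the alphabet $\{2,3\}$); (ii) $C_Z(1)=1$, and $\Delta C_Z$ is the fixed point of the morphism on the alphabet $\{1,3,4\}$ given by $1\mapsto 14,\ 3\mapsto 14,\ 4\mapsto 3$; (iii) $D_Z(1)=-1$, and $\Delta D_Z$ is the fixed point of the morphism $5\mapsto 53,\ 3\mapsto 5$ (on the alphabet $\{3,5\}$).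
   Context: Fibonacci numbers: $F_0=0$, $F_1=1$, $F_n=F_{n-1}+F_{n-2}$. Every integer $N\ge0$ has a unique Zeckendorf expansion $N=\sum_{i\ge0}d_i(N)F_{i+2}$ with $d_i(N)\in\{0,1\}$ and no two consecutive digits equal to $1$; $s_Z(N)=\sum_i d_i(N)$. An integer $N\ge0$ is a point of increase, constancy, or decrease of $s_Z$ according as $s_Z(N+1)-s_Z(N)$ is $>0$, $=0$, or $<0$. For a sequence $V=(V(n))_{n\ge1}$, $\Delta V$ denotes the sequence $(V(n+1)-V(n))_{n\ge1}$, viewed as an infinite word. For a morphism $\mu$ and a letter $a$ with $\mu(a)$ beginning with $a$ and of length $\ge2$, the fixed point of $\mu$ is the infinite word $\lim_n\mu^n(a)$; in each case here the fixed point is unique. -}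

module Defs where

open import Data.Digit using (Bit; 0b; 1b)
open import Data.Empty using (⊥-elim)
open import Data.Fin.Base using (toℕ)
open import Data.Fin.Patterns using (0F; 1F)
open import Data.Integer.Base as ℤ using (ℤ; -1ℤ)
open import Data.List.Base using (List; []; _∷_; _++_; map; length; replicate; take; applyUpTo; concatMap)
open import Data.List.Properties using (length-++; length-replicate)
open import Data.List.Relation.Unary.Linked as Linked using (Linked; []; [-]; _∷_)
open import Data.Nat.Base
open import Data.Nat.GeneralisedArithmetic using (fold)
open import Data.Nat.ListAction using (sum)
open import Data.Nat.Properties
open import Data.Product.Base using (Σ-syntax; ∃; ∃-syntax; _×_; _,_; proj₁; proj₂)
open import Data.Sum.Base using (inj₁; inj₂)
open import Function.Base using (_∘_)
open import Relation.Binary.Definitions using (Tri; tri<; tri≈; tri>)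
open import Relation.Binary.PropositionalEquality
open import Relation.Nullary using (¬_; yes; no)
open import Relation.Unary using (Pred; Decidable)
open import Level using (0ℓ)

------------------------------------------------------------------------
-- Zeckendorf expansions

F : ℕ → ℕ
F 0             = 0
F 1             = 1
F (suc (suc n)) = F (suc n) + F n

-- Digit lists have the most significant digit first, so the digit in
-- front of ds is the one of index length ds.

value : List Bit → ℕ
value []       = 0
value (d ∷ ds) = toℕ d * F (2 + length ds) + value ds

NoConsecutiveOnes : List Bit → Set
NoConsecutiveOnes = Linked (λ d e → ¬ (d ≡ 1b × e ≡ 1b))

digitSum : List Bit → ℕ
digitSum ds = sum (map toℕ ds)

-- Leading zeros are allowed, as in the expansions Σ_{i≥0} d_i F_{i+2};
-- they do not affect digitSum.

record Zeckendorf (N : ℕ) : Set where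
  constructor mkZeckendorf
  field
    digits  : List Bit
    noOnes² : NoConsecutiveOnes digits
    value≡  : value digits ≡ N

open Zeckendorf public

private
  0∷-noOnes² : ∀ {ds} → NoConsecutiveOnes ds → NoConsecutiveOnes (0b ∷ ds)
  0∷-noOnes² {[]}    _  = [-]
  0∷-noOnes² {_ ∷ _} ok = (λ { (() , _) }) ∷ ok

  10∷-noOnes² : ∀ {ds} → NoConsecutiveOnes ds → NoConsecutiveOnes (1b ∷ 0b ∷ ds)
  10∷-noOnes² ok = (λ { (_ , ()) }) ∷ 0∷-noOnes² ok

  F-pos : ∀ n → 1 ≤ F (suc n)
  F-pos zero    = ≤-refl
  F-pos (suc n) = ≤-trans (F-pos n) (m≤m+n _ _)

  F-lower : ∀ n → suc n ≤ F (2 + n)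
  F-lower zero    = ≤-refl
  F-lower (suc n) = subst (_≤ F (3 + n)) (+-comm (suc n) 1) (+-mono-≤ (F-lower n) (F-pos n))

  greedy : ∀ n N → N < F (2 + n) → Σ[ z ∈ Zeckendorf N ] length (digits z) ≡ n
  greedy zero    zero    _        = mkZeckendorf [] [] refl , refl
  greedy zero    (suc N) (s≤s ())
  greedy (suc n) N N<F with N <? F (2 + n)
  greedy (suc n) N N<F | yes N<F′ with greedy n N N<F′
  ... | mkZeckendorf ds ok eq , len = mkZeckendorf (0b ∷ ds) (0∷-noOnes² ok) eq , cong suc len
  greedy (suc zero) zero N<F | no N≮F = ⊥-elim (N≮F (s≤s z≤n))
  greedy (suc zero) (suc zero) N<F | no N≮F = mkZeckendorf (1b ∷ []) [-] refl , refl
  greedy (suc zero) (suc (suc N)) (s≤s (s≤s ())) | no N≮F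
  greedy (suc (suc n)) N N<F | no N≮F with greedy n (N ∸ F (3 + n)) rest
    where
    F≤N : F (3 + n) ≤ N
    F≤N = ≮⇒≥ N≮F
    rest : N ∸ F (3 + n) < F (2 + n)
    rest = subst (N ∸ F (3 + n) <_) (m+n∸m≡n (F (3 + n)) (F (2 + n))) (∸-monoˡ-< N<F F≤N)
  ... | mkZeckendorf ds ok eq , len =
    mkZeckendorf (1b ∷ 0b ∷ ds) (10∷-noOnes² ok) eq′ , cong (suc ∘ suc) len
    where
    open ≡-Reasoning
    eq′ : 1 * F (3 + length ds) + value ds ≡ N
    eq′ = begin
      1 * F (3 + length ds) + value ds  ≡⟨ cong₂ _+_ (trans (*-identityˡ _) (cong (F ∘ (3 +_)) len)) eq ⟩
      F (3 + n) + (N ∸ F (3 + n))       ≡⟨ m+[n∸m]≡n (≮⇒≥ N≮F) ⟩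
      N                                 ∎

zeckendorf : ∀ N → Zeckendorf N
zeckendorf N = proj₁ (greedy N N (F-lower N))

s_Z : ℕ → ℕ
s_Z N = digitSum (digits (zeckendorf N))

private
  value-1∷ : ∀ ds → value (1b ∷ ds) ≡ F (2 + length ds) + value ds
  value-1∷ ds = cong (_+ value ds) (*-identityˡ (F (2 + length ds)))

  value< : ∀ ds → NoConsecutiveOnes ds → value ds < F (2 + length ds)
  value< []             _        = s≤s z≤n
  value< (0F ∷ ds)      ok       = <-≤-trans (value< ds (Linked.tail ok)) (m≤m+n _ _)
  value< (1F ∷ [])      _        = s≤s (s≤s z≤n)
  value< (1F ∷ 0F ∷ ds) ok       =
    subst (_< F (4 + length ds)) (sym (value-1∷ (0b ∷ ds)))
      (+-monoʳ-< (F (3 + length ds)) (value< ds (Linked.tail (Linked.tail ok))))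
  value< (1F ∷ 1F ∷ ds) (r ∷ _)  = ⊥-elim (r (refl , refl))

  F-step : ∀ n → F (2 + n) ≤ F (3 + n)
  F-step n = m≤m+n _ _

  F-mono : ∀ {m n} → m ≤ n → F (2 + m) ≤ F (2 + n)
  F-mono {m} {n} m≤n with m≤n⇒m<n∨m≡n m≤n
  F-mono {m} {suc n} _ | inj₁ (s≤s m≤n) = ≤-trans (F-mono m≤n) (F-step n)
  F-mono             _ | inj₂ refl      = ≤-refl

  value≢ : ∀ {ds es} → NoConsecutiveOnes ds → length ds ≤ length es →
           value ds ≢ value (1b ∷ es)
  value≢ {ds} {es} ok len eq = <-irrefl eq (begin-strict
    value ds                      <⟨ value< ds ok ⟩
    F (2 + length ds)             ≤⟨ F-mono len ⟩
    F (2 + length es)             ≤⟨ m≤m+n _ _ ⟩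
    F (2 + length es) + value es  ≡⟨ value-1∷ es ⟨
    value (1b ∷ es)               ∎)
    where open ≤-Reasoning

  LengthOrder : List Bit → List Bit → Set
  LengthOrder ds es = Tri (length ds < length es) (length ds ≡ length es) (length ds > length es)

  compareLength : ∀ ds es → LengthOrder ds es
  compareLength ds es = <-cmp (length ds) (length es)

  sums≡ : ∀ ds es → LengthOrder ds es → NoConsecutiveOnes ds → NoConsecutiveOnes es →
          value ds ≡ value es → digitSum ds ≡ digitSum es
  sums≡ []        []        _             okd oke eq = refl
  sums≡ ds        (0F ∷ es) (tri< _ _ _)  okd oke eq =
    sums≡ ds es (compareLength ds es) okd (Linked.tail oke) eq
  sums≡ ds        (1F ∷ es) (tri< lt _ _) okd oke eq =
    ⊥-elim (value≢ {es = es} okd (≤-pred lt) eq)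
  sums≡ (0F ∷ ds) es        (tri> _ _ _)  okd oke eq =
    sums≡ ds es (compareLength ds es) (Linked.tail okd) oke eq
  sums≡ (1F ∷ ds) es        (tri> _ _ gt) okd oke eq =
    ⊥-elim (value≢ {es = ds} oke (≤-pred gt) (sym eq))
  sums≡ (0F ∷ ds) (0F ∷ es) (tri≈ _ _ _)  okd oke eq =
    sums≡ ds es (compareLength ds es) (Linked.tail okd) (Linked.tail oke) eq
  sums≡ (0F ∷ ds) (1F ∷ es) (tri≈ _ l _)  okd oke eq =
    ⊥-elim (value≢ {es = es} (Linked.tail okd) (≤-reflexive (suc-injective l)) eq)
  sums≡ (1F ∷ ds) (0F ∷ es) (tri≈ _ l _)  okd oke eq =
    ⊥-elim (value≢ {es = ds} (Linked.tail oke) (≤-reflexive (sym (suc-injective l))) (sym eq))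
  sums≡ (1F ∷ ds) (1F ∷ es) (tri≈ _ l _)  okd oke eq =
    cong suc (sums≡ ds es (compareLength ds es) (Linked.tail okd) (Linked.tail oke)
      (+-cancelˡ-≡ (1 * F (2 + length ds)) (value ds) (value es)
        (trans eq (cong (λ n → 1 * F (2 + n) + value es) (sym (suc-injective l))))))

digitSum-unique : ∀ {N} (y z : Zeckendorf N) → digitSum (digits y) ≡ digitSum (digits z)
digitSum-unique (mkZeckendorf ds okd eqd) (mkZeckendorf es oke eqe) =
  sums≡ ds es (compareLength ds es) okd oke (trans eqd (sym eqe))

------------------------------------------------------------------------
-- Increasing enumerations

record IsIncreasingEnumeration (P : Pred ℕ 0ℓ) (e : ℕ → ℕ) : Set where
  field
    increasing : ∀ n → e n < e (suc n)
    sound      : ∀ n → P (e n)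
    complete   : ∀ N → P N → ∃[ n ] e n ≡ N

Unbounded : Pred ℕ 0ℓ → Set
Unbounded P = ∀ m → ∃[ N ] m ≤ N × P N

module _ {P : Pred ℕ 0ℓ} (P? : Decidable P) (unb : Unbounded P) where

  private
    LeastFrom : ℕ → ℕ → Set
    LeastFrom m n = m ≤ n × P n × (∀ j → m ≤ j → P j → n ≤ j)

    search : ∀ k m → P (k + m) → ∃ (LeastFrom m)
    search k m p with P? m
    search k       m p | yes q = m , ≤-refl , q , λ _ m≤j _ → m≤j
    search zero    m p | no ¬q = ⊥-elim (¬q p)
    search (suc k) m p | no ¬q with search k (suc m) (subst P (sym (+-suc k m)) p)
    ... | n , m<n , q , least = n , <⇒≤ m<n , q , least′
      where
      least′ : ∀ j → m ≤ j → P j → n ≤ j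
      least′ j m≤j r with m≤n⇒m<n∨m≡n m≤j
      ... | inj₁ m<j  = least j m<j r
      ... | inj₂ refl = ⊥-elim (¬q r)

    leastFrom : ∀ m → ∃ (LeastFrom m)
    leastFrom m with unb m
    ... | N , m≤N , p = search (N ∸ m) m (subst P (sym (m∸n+n≡m m≤N)) p)

  enumerate : ℕ → ℕ
  enumerate zero    = proj₁ (leastFrom 0)
  enumerate (suc n) = proj₁ (leastFrom (suc (enumerate n)))

  private
    n≤enumerate : ∀ n → n ≤ enumerate n
    n≤enumerate zero    = z≤n
    n≤enumerate (suc n) =
      ≤-trans (s≤s (n≤enumerate n)) (proj₁ (proj₂ (leastFrom (suc (enumerate n)))))

    enumerate-sound : ∀ n → P (enumerate n)
    enumerate-sound zero    = proj₁ (proj₂ (proj₂ (leastFrom 0)))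
    enumerate-sound (suc n) = proj₁ (proj₂ (proj₂ (leastFrom (suc (enumerate n)))))

    hit : ∀ n N → N ≤ enumerate n → P N → ∃[ i ] enumerate i ≡ N
    hit zero N le p =
      zero , ≤-antisym (proj₂ (proj₂ (proj₂ (leastFrom 0))) N z≤n p) le
    hit (suc n) N le p with N ≤? enumerate n
    ... | yes le′ = hit n N le′ p
    ... | no  nle = suc n , ≤-antisym
      (proj₂ (proj₂ (proj₂ (leastFrom (suc (enumerate n))))) N (≰⇒> nle) p) le

  enumerate-isIncreasingEnumeration : IsIncreasingEnumeration P enumerate
  enumerate-isIncreasingEnumeration = record
    { increasing = λ n → proj₁ (proj₂ (leastFrom (suc (enumerate n))))
    ; sound      = enumerate-sound
    ; complete   = λ N → hit N N (n≤enumerate N)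
    }

------------------------------------------------------------------------
-- Points of increase, constancy and decrease

Increase Constancy Decrease : Pred ℕ 0ℓ
Increase  N = s_Z (suc N) > s_Z N
Constancy N = s_Z (suc N) ≡ s_Z N
Decrease  N = s_Z (suc N) < s_Z N

increase? : Decidable Increase
increase? N = s_Z N <? s_Z (suc N)

constancy? : Decidable Constancy
constancy? N = s_Z (suc N) ≟ s_Z N

decrease? : Decidable Decrease
decrease? N = s_Z (suc N) <? s_Z N

private
  s_Z-value : ∀ ds → NoConsecutiveOnes ds → s_Z (value ds) ≡ digitSum ds
  s_Z-value ds ok = digitSum-unique (zeckendorf _) (mkZeckendorf ds ok refl)

  -- 1 0 0^m p
  pad : ℕ → List Bit → List Bit
  pad m p = 1b ∷ 0b ∷ replicate m 0b ++ p

  zeros-noOnes² : ∀ m {p} → NoConsecutiveOnes p → NoConsecutiveOnes (replicate m 0b ++ p)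
  zeros-noOnes² zero    ok = ok
  zeros-noOnes² (suc m) ok = 0∷-noOnes² (zeros-noOnes² m ok)

  value-zeros : ∀ m p → value (replicate m 0b ++ p) ≡ value p
  value-zeros zero    p = refl
  value-zeros (suc m) p = value-zeros m p

  digitSum-zeros : ∀ m p → digitSum (replicate m 0b ++ p) ≡ digitSum p
  digitSum-zeros zero    p = refl
  digitSum-zeros (suc m) p = digitSum-zeros m p

  length-zeros : ∀ m p → length (replicate m 0b ++ p) ≡ m + length p
  length-zeros m p =
    trans (length-++ (replicate m 0b)) (cong (_+ length p) (length-replicate m))

  value-pad : ∀ m p → value (pad m p) ≡ F (3 + (m + length p)) + value p
  value-pad m p = trans (value-1∷ (0b ∷ replicate m 0b ++ p))
    (cong₂ _+_ (cong (F ∘ (3 +_)) (length-zeros m p)) (value-zeros m p))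

  m≤value-pad : ∀ m p → m ≤ value (pad m p)
  m≤value-pad m p = begin
    m                                  ≤⟨ m≤m+n m (length p) ⟩
    m + length p                       ≤⟨ m≤n+m _ 2 ⟩
    2 + (m + length p)                 ≤⟨ F-lower (suc (m + length p)) ⟩
    F (3 + (m + length p))             ≤⟨ m≤m+n _ _ ⟩
    F (3 + (m + length p)) + value p   ≡⟨ value-pad m p ⟨
    value (pad m p)                    ∎
    where open ≤-Reasoning

  s_Z-pad : ∀ m {p} → NoConsecutiveOnes p → s_Z (value (pad m p)) ≡ suc (digitSum p)
  s_Z-pad m {p} ok = trans (s_Z-value (pad m p) (10∷-noOnes² (zeros-noOnes² m ok)))
    (cong suc (digitSum-zeros m p))

  module _ (p q : List Bit) (okp : NoConsecutiveOnes p) (okq : NoConsecutiveOnes q)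
           (len : length p ≡ length q) (suc-value : value q ≡ suc (value p)) where

    value-pad-suc : ∀ m → value (pad m q) ≡ suc (value (pad m p))
    value-pad-suc m = begin
      value (pad m q)                             ≡⟨ value-pad m q ⟩
      F (3 + (m + length q)) + value q            ≡⟨ cong₂ (λ l v → F (3 + (m + l)) + v) (sym len) suc-value ⟩
      F (3 + (m + length p)) + suc (value p)      ≡⟨ +-suc _ (value p) ⟩
      suc (F (3 + (m + length p)) + value p)      ≡⟨ cong suc (value-pad m p) ⟨
      suc (value (pad m p))                       ∎
      where open ≡-Reasoning

    unbounded : (R : ℕ → ℕ → Set) → R (suc (digitSum q)) (suc (digitSum p)) →
                Unbounded (λ N → R (s_Z (suc N)) (s_Z N))
    unbounded R r m = value (pad m p) , m≤value-pad m p ,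
      subst₂ R
        (trans (sym (s_Z-pad m okq)) (cong s_Z (value-pad-suc m)))
        (sym (s_Z-pad m okp))
        r

  00-ok : NoConsecutiveOnes (0b ∷ 0b ∷ [])
  00-ok = 0∷-noOnes² [-]

  01-ok : NoConsecutiveOnes (0b ∷ 1b ∷ [])
  01-ok = 0∷-noOnes² [-]

  10-ok : NoConsecutiveOnes (1b ∷ 0b ∷ [])
  10-ok = 10∷-noOnes² []

increase-unbounded : Unbounded Increase
increase-unbounded =
  unbounded (0b ∷ 0b ∷ []) (0b ∷ 1b ∷ []) 00-ok 01-ok refl refl _>_ ≤-refl

constancy-unbounded : Unbounded Constancy
constancy-unbounded =
  unbounded (0b ∷ 1b ∷ []) (1b ∷ 0b ∷ []) 01-ok 10-ok refl refl _≡_ refl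

decrease-unbounded : Unbounded Decrease
decrease-unbounded =
  unbounded (0b ∷ 1b ∷ 0b ∷ 1b ∷ []) (1b ∷ 0b ∷ 0b ∷ 0b ∷ [])
    (0∷-noOnes² (10∷-noOnes² [-])) (10∷-noOnes² 00-ok) refl refl _<_ ≤-refl

-- Sequences (V(n))_{n≥1} are represented as functions on ℕ whose value
-- at n is V(n+1). They are ℤ-valued because D_Z starts with -1.

I_Z C_Z D_Z : ℕ → ℤ
I_Z n       = ℤ.+ enumerate increase? increase-unbounded n
C_Z n       = ℤ.+ enumerate constancy? constancy-unbounded n
D_Z zero    = -1ℤ
D_Z (suc n) = ℤ.+ enumerate decrease? decrease-unbounded n

Δ : (ℕ → ℤ) → (ℕ → ℤ)
Δ V n = V (suc n) ℤ.- V n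

------------------------------------------------------------------------
-- Fixed points of morphisms of words

module _ {A : Set} where

  -- Every prefix of the infinite word w is eventually the prefix of u n.

  IsLimit : (ℕ → List A) → (ℕ → A) → Set
  IsLimit u w = ∀ k → ∃[ m ] (∀ n → m ≤ n → take k (u n) ≡ applyUpTo w k)

  power : (A → List A) → ℕ → A → List A
  power μ n a = fold (a ∷ []) (concatMap μ) n

  -- μ a begins with a and has length at least 2.

  Prolongable : (A → List A) → A → Set
  Prolongable μ a = ∃[ b ] ∃[ v ] μ a ≡ a ∷ b ∷ v

  IsFixedPoint : (A → List A) → (ℕ → A) → Set
  IsFixedPoint μ w = ∃[ a ] Prolongable μ a × IsLimit (λ n → power μ n a) w

-- The alphabet A consists of the integers ⟦ a ⟧.

IsFixedPointOf : {A : Set} → (A → ℤ) → (A → List A) → (ℕ → ℤ) → Set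
IsFixedPointOf ⟦_⟧ μ V = ∃[ w ] IsFixedPoint μ w × (∀ n → V n ≡ ⟦ w n ⟧)

data Alphabet-I : Set where
  𝟐 𝟑 : Alphabet-I

data Alphabet-C : Set where
  𝟏 𝟑 𝟒 : Alphabet-C

data Alphabet-D : Set where
  𝟑 𝟓 : Alphabet-D

⟦_⟧I : Alphabet-I → ℤ
⟦ 𝟐 ⟧I = ℤ.+ 2
⟦ 𝟑 ⟧I = ℤ.+ 3

⟦_⟧C : Alphabet-C → ℤ
⟦ 𝟏 ⟧C = ℤ.+ 1
⟦ 𝟑 ⟧C = ℤ.+ 3
⟦ 𝟒 ⟧C = ℤ.+ 4

⟦_⟧D : Alphabet-D → ℤ
⟦ 𝟑 ⟧D = ℤ.+ 3
⟦ 𝟓 ⟧D = ℤ.+ 5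

μ-I : Alphabet-I → List Alphabet-I
μ-I 𝟑 = 𝟑 ∷ 𝟐 ∷ []
μ-I 𝟐 = 𝟑 ∷ []

μ-C : Alphabet-C → List Alphabet-C
μ-C 𝟏 = 𝟏 ∷ 𝟒 ∷ []
μ-C 𝟑 = 𝟏 ∷ 𝟒 ∷ []
μ-C 𝟒 = 𝟑 ∷ []

μ-D : Alphabet-D → List Alphabet-D
μ-D 𝟓 = 𝟓 ∷ 𝟑 ∷ []
μ-D 𝟑 = 𝟓 ∷ []

{-# OPTIONS --safe #-}

-- For j < F(n+2) the Zeckendorf expansion of F(n+3) + j is that of j with
-- one further digit 1.  Hence the increments of s_Z have the same trend at
-- j and at F(n+6) + j for all j ≤ F(n+5) + 1: at j = F(n+5) - 1, where the
-- addition carries, both are decreases.  So if e enumerates the points of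
-- one kind, and e(ℓ) = F(n+5) + e(0), e(ℓ′) = F(n+6) + e(0), the first
-- ℓ′ + ℓ gaps of e are its first ℓ′ gaps followed by its first ℓ gaps.  The
-- words uₙ = μⁿ(a) of the three morphisms satisfy the same recurrence
-- uₙ₊₂ = uₙ₊₁ uₙ, and it remains to compare the first two words.  For the
-- points of decrease, -1 is included and everything is shifted by 1.

module Submission where

open import Defs
open import Data.Digit using (0b; 1b)
open import Data.Integer.Base as ℤ using (ℤ; 0ℤ; 1ℤ; -1ℤ; _⊖_)
open import Data.Integer.Properties using (m-n≡m⊖n; [1+m]⊖[1+n]≡m⊖n; +-cancelˡ-⊖)
open import Data.List.Base using (List; []; _∷_; _++_; map; length; take; applyUpTo; concatMap)
open import Data.List.Properties
  using (map-++; map-∘; map-cong; map-id; map-applyUpTo; length-++; concatMap-++; ∷-injective)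
open import Data.List.Relation.Unary.Linked using ([]; [-]; _∷_)
open import Data.Nat.Base
open import Data.Nat.Properties
open import Data.Product.Base using (Σ-syntax; ∃-syntax; _×_; _,_; proj₁; proj₂)
open import Data.Sum.Base using (_⊎_; inj₁; inj₂; [_,_]′)
open import Data.Unit.Base using (⊤; tt)
open import Function.Base using (_∘_; id)
open import Function.Bundles using (_⇔_; mk⇔; module Equivalence)
open import Level using (0ℓ)
open import Relation.Binary.Core using (Rel)
open import Relation.Binary.Definitions using (tri<; tri≈; tri>)
open import Relation.Binary.PropositionalEquality
open import Relation.Nullary using (yes; no; contradiction)
open import Relation.Unary using (Pred)

open Equivalence using (to; from)

-- Digit sums under addition of a Fibonacci number

F-positive : ∀ n → 0 < F (suc n)
F-positive zero    = ≤-refl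
F-positive (suc n) = ≤-trans (F-positive n) (m≤m+n _ _)

2<F : ∀ n → 2 < F (4 + n)
2<F zero    = ≤-refl
2<F (suc n) = ≤-trans (2<F n) (m≤m+n _ _)

0∷-noOnes : ∀ {ds} → NoConsecutiveOnes ds → NoConsecutiveOnes (0b ∷ ds)
0∷-noOnes {[]}    _  = [-]
0∷-noOnes {_ ∷ _} ok = (λ { (() , _) }) ∷ ok

-- Leading zeros pad the list to exactly `n` digits, which fixes the weight of a digit put in front
-- of it.
ZeckendorfOfLength : ℕ → ℕ → Set
ZeckendorfOfLength n N = Σ[ z ∈ Zeckendorf N ] length (digits z) ≡ n

prepend-0 : ∀ {n N} → ZeckendorfOfLength n N → ZeckendorfOfLength (suc n) N
prepend-0 (mkZeckendorf ds ok eq , len) =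
  mkZeckendorf (0b ∷ ds) (0∷-noOnes ok) eq , cong suc len

prepend-10 : ∀ {n N} → ZeckendorfOfLength n N → ZeckendorfOfLength (2 + n) (F (3 + n) + N)
prepend-10 (mkZeckendorf ds ok eq , len) =
  mkZeckendorf (1b ∷ 0b ∷ ds) ((λ { (_ , ()) }) ∷ 0∷-noOnes ok)
    (cong₂ _+_ (trans (*-identityˡ _) (cong (F ∘ (3 +_)) len)) eq) , cong (2 +_) len

<-+-split : ∀ m {n k} → k < m + n → k < m ⊎ ∃[ l ] m + l ≡ k × l < n
<-+-split m {n} {k} k<m+n with k <? m
... | yes k<m = inj₁ k<m
... | no  k≮m with m≤n⇒∃[o]m+o≡n (≮⇒≥ k≮m)
...   | l , refl = inj₂ (l , refl , +-cancelˡ-< m l n k<m+n)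

ofLength : ∀ n {N} → N < F (2 + n) → ZeckendorfOfLength n N
ofLength zero       {zero}        _              = mkZeckendorf [] [] refl , refl
ofLength zero       {suc _}       (s≤s ())
ofLength (suc zero) {zero}        _              = mkZeckendorf (0b ∷ []) [-] refl , refl
ofLength (suc zero) {suc zero}    _              = mkZeckendorf (1b ∷ []) [-] refl , refl
ofLength (suc zero) {suc (suc _)} (s≤s (s≤s ()))
ofLength (suc (suc n)) N<F = [ (λ N<F′ → prepend-0 (ofLength (suc n) N<F′))
                             , (λ { (_ , refl , M<F) → prepend-10 (ofLength n M<F) })
                             ]′ (<-+-split (F (3 + n)) N<F)

-- Prefixing `10` to an `n`-digit expansion of `j` keeps it admissible, and by uniqueness any
-- expansion computes `s_Z`.
s_Z-F+ : ∀ n {j} → j < F (2 + n) → s_Z (F (3 + n) + j) ≡ suc (s_Z j)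
s_Z-F+ n {j} j<F = trans
  (digitSum-unique (zeckendorf _) (proj₁ (prepend-10 z)))
  (cong suc (digitSum-unique (proj₁ z) (zeckendorf j)))
  where
  z : ZeckendorfOfLength n j
  z = ofLength n j<F

s_Z-F : ∀ n → s_Z (F (3 + n)) ≡ 1
s_Z-F n = trans (cong s_Z (sym (+-identityʳ (F (3 + n))))) (s_Z-F+ n (F-positive (suc n)))

-- Each step of two indices adds a digit 1, as F(7+n) - 1 = F(6+n) + (F(5+n) - 1). The bound fails
-- for F(4) - 1 = 2, hence the start at F(5).
1<s_Z-pred-F : ∀ n → ∃[ j ] suc j ≡ F (5 + n) × 1 < s_Z j
1<s_Z-pred-F zero          = 4 , refl , ≤-refl
1<s_Z-pred-F (suc zero)    = 7 , refl , ≤-refl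
1<s_Z-pred-F (suc (suc n)) with 1<s_Z-pred-F n
... | j , j+1≡F , 1<s = F (6 + n) + j ,
  trans (sym (+-suc (F (6 + n)) j)) (cong (F (6 + n) +_) j+1≡F) ,
  subst (1 <_) (sym (s_Z-F+ (3 + n) (≤-reflexive j+1≡F))) (m<n⇒m<1+n 1<s)

-- The two Fibonacci numbers merge into the single digit F(7+n), so the number of ones is unchanged.
-- The bound 3 leaves room for `suc i` with `i ≤ 1`.
s_Z-F+F+ : ∀ n {i} → i < 3 → s_Z (F (6 + n) + (F (5 + n) + i)) ≡ s_Z (F (5 + n) + i)
s_Z-F+F+ n {i} i<3 = begin
  s_Z (F (6 + n) + (F (5 + n) + i))  ≡⟨ cong s_Z (+-assoc (F (6 + n)) (F (5 + n)) i) ⟨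
  s_Z (F (7 + n) + i)                ≡⟨ s_Z-F+ (4 + n) (<-≤-trans i<3 (2<F (2 + n))) ⟩
  suc (s_Z i)                        ≡⟨ s_Z-F+ (2 + n) (<-≤-trans i<3 (2<F n)) ⟨
  s_Z (F (5 + n) + i)                ∎
  where open ≡-Reasoning

-- Trends of `s_Z` under a Fibonacci shift

module Trend (R : Rel ℕ 0ℓ) (R-suc : ∀ {a b} → R a b ⇔ R (suc a) (suc b))
             (R-carry : ∀ {b} → 1 < b → R 1 b ⇔ R 1 (suc b)) where

  HasTrend : Pred ℕ 0ℓ
  HasTrend j = R (s_Z (suc j)) (s_Z j)

  private
    transfer : ∀ j k {a b} → s_Z (suc k) ≡ a → s_Z k ≡ b →
               HasTrend j ⇔ R a b → HasTrend j ⇔ HasTrend k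
    transfer _ _ refl refl j⇔k = j⇔k

  -- Below F(5+n) - 1 the shift raises both digit sums by 1, and from F(5+n) on it changes neither.
  -- `R-carry` serves the one point between, where the two successors F(5+n) and F(7+n) have digit
  -- sum 1.
  trend-shift : ∀ n {j} → j ≤ suc (F (5 + n)) → HasTrend j ⇔ HasTrend (F (6 + n) + j)
  trend-shift n {j} j≤ with <-cmp (suc j) (F (5 + n))
  ... | tri< j+1<F _ _ = transfer j (F (6 + n) + j)
    (trans (cong s_Z (sym (+-suc (F (6 + n)) j))) (s_Z-F+ (3 + n) j+1<F))
    (s_Z-F+ (3 + n) (<-trans (n<1+n j) j+1<F))
    R-suc
  ... | tri≈ _ j+1≡F _ with 1<s_Z-pred-F n
  ...   | i , i+1≡F , 1<s with suc-injective (trans i+1≡F (sym j+1≡F))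
  ...     | refl = transfer j (F (6 + n) + j)
    (trans (cong s_Z (trans (sym (+-suc (F (6 + n)) j)) (cong (F (6 + n) +_) j+1≡F))) (s_Z-F (4 + n)))
    (s_Z-F+ (3 + n) (≤-reflexive j+1≡F))
    (subst (λ a → R a (s_Z j) ⇔ R 1 (suc (s_Z j)))
      (sym (trans (cong s_Z j+1≡F) (s_Z-F (2 + n)))) (R-carry 1<s))
  trend-shift n {j} j≤ | tri> _ _ F<j+1 with m≤n⇒∃[o]m+o≡n (s≤s⁻¹ F<j+1)
  ... | i , refl = transfer (F (5 + n) + i) (F (6 + n) + (F (5 + n) + i))
    (begin
      s_Z (suc (F (6 + n) + (F (5 + n) + i)))  ≡⟨ cong s_Z (+-suc (F (6 + n)) (F (5 + n) + i)) ⟨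
      s_Z (F (6 + n) + suc (F (5 + n) + i))    ≡⟨ cong (λ k → s_Z (F (6 + n) + k)) (+-suc (F (5 + n)) i) ⟨
      s_Z (F (6 + n) + (F (5 + n) + suc i))    ≡⟨ s_Z-F+F+ n (s≤s (s≤s i≤1)) ⟩
      s_Z (F (5 + n) + suc i)                  ≡⟨ cong s_Z (+-suc (F (5 + n)) i) ⟩
      s_Z (suc (F (5 + n) + i))                ∎)
    (s_Z-F+F+ n (s≤s (m≤n⇒m≤1+n i≤1)))
    (mk⇔ id id)
    where
    open ≡-Reasoning
    i≤1 : i ≤ 1
    i≤1 = +-cancelˡ-≤ (F (5 + n)) i 1 (subst (F (5 + n) + i ≤_) (+-comm 1 (F (5 + n))) j≤)

module Inc = Trend _>_ (mk⇔ s≤s s≤s⁻¹)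
  (λ 1<b → mk⇔ (λ b<1 → contradiction b<1 (<-asym 1<b))
               (λ b<0 → contradiction (<-trans (n<1+n _) b<0) (<-asym 1<b)))

module Const = Trend _≡_ (mk⇔ (cong suc) suc-injective)
  (λ 1<b → mk⇔ (λ 1≡b → contradiction 1≡b (<⇒≢ 1<b))
               (λ 1≡1+b → contradiction 1≡1+b (<⇒≢ (m<n⇒m<1+n 1<b))))

module Dec = Trend _<_ (mk⇔ s≤s s≤s⁻¹) (λ 1<b → mk⇔ m<n⇒m<1+n (λ _ → 1<b))

-- Gaps of increasing enumerations

module Enumeration {P : Pred ℕ 0ℓ} {e : ℕ → ℕ} (enum : IsIncreasingEnumeration P e) where

  open IsIncreasingEnumeration enum

  gap : ℕ → ℤ
  gap n = e (suc n) ⊖ e n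

  e-mono : ∀ {i j} → i ≤ j → e i ≤ e j
  e-mono {i} i≤j with m≤n⇒∃[o]m+o≡n i≤j
  ... | o , refl = e≤ o
    where
    e≤ : ∀ o → e i ≤ e (i + o)
    e≤ zero    = ≤-reflexive (cong e (sym (+-identityʳ i)))
    e≤ (suc o) = ≤-trans (e≤ o)
      (subst (λ k → e (i + o) ≤ e k) (sym (+-suc i o)) (<⇒≤ (increasing (i + o))))

  e-suc-least : ∀ {i j} → e i < j → P j → e (suc i) ≤ j
  e-suc-least {i} ei<j Pj with complete _ Pj
  ... | k , refl = e-mono (≰⇒> λ k≤i → <⇒≱ ei<j (e-mono k≤i))

  e-suc-shift : ∀ {c i k} → e i ≡ c + e k → (∀ {j} → j ≤ e (suc k) → P j ⇔ P (c + j)) →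
                e (suc i) ≡ c + e (suc k)
  e-suc-shift {c} {i} {k} ei≡ P⇔ = ≤-antisym upper lower
    where
    upper : e (suc i) ≤ c + e (suc k)
    upper = e-suc-least (subst (_< c + e (suc k)) (sym ei≡) (+-monoʳ-< c (increasing k)))
      (to (P⇔ ≤-refl) (sound (suc k)))

    c+ek<e : c + e k < e (suc i)
    c+ek<e = subst (_< e (suc i)) ei≡ (increasing i)

    lower : c + e (suc k) ≤ e (suc i)
    lower with m≤n⇒∃[o]m+o≡n (≤-trans (m≤m+n c (e k)) (<⇒≤ c+ek<e))
    -- `e (suc i)` is `c + j`, and `upper` gives `j ≤ e (suc k)`: this is the range in which `P⇔`
    -- takes `P` back to `j`.
    ... | j , c+j≡ = subst (c + e (suc k) ≤_) c+j≡ (+-monoʳ-≤ c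
      (e-suc-least (+-cancelˡ-< c (e k) j (subst (c + e k <_) (sym c+j≡) c+ek<e))
        (from (P⇔ (+-cancelˡ-≤ c j (e (suc k)) (subst (_≤ c + e (suc k)) (sym c+j≡) upper)))
          (subst P (sym c+j≡) (sound (suc i))))))

  module Blocks (L : ℕ → ℕ) (L-rec : ∀ n → L (2 + n) ≡ L (1 + n) + L n)
                (e-L₀ : e (L 0) ≡ F 5 + e 0) (e-L₁ : e (L 1) ≡ F 6 + e 0)
                (P-shift : ∀ n {j} → j ≤ F (5 + n) + e 0 → P j ⇔ P (F (6 + n) + j)) where

    -- The values of `e` at the block ends are hypotheses because the induction in `e-L` itself uses
    -- this lemma, at `k = L n`.
    e-shift′ : ∀ n → e (L n) ≡ F (5 + n) + e 0 → e (L (suc n)) ≡ F (6 + n) + e 0 →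
               ∀ k → k ≤ L n → e (L (suc n) + k) ≡ F (6 + n) + e k
    e-shift′ n eq eq′ zero    _   = trans (cong e (+-identityʳ _)) eq′
    e-shift′ n eq eq′ (suc k) k<L = trans (cong e (+-suc _ k))
      (e-suc-shift (e-shift′ n eq eq′ k (<⇒≤ k<L))
        (λ j≤ → P-shift n (≤-trans j≤ (≤-trans (e-mono k<L) (≤-reflexive eq)))))

    e-L : ∀ n → e (L n) ≡ F (5 + n) + e 0
    e-L zero          = e-L₀
    e-L (suc zero)    = e-L₁
    e-L (suc (suc n)) = begin
      e (L (2 + n))                    ≡⟨ cong e (L-rec n) ⟩
      e (L (1 + n) + L n)              ≡⟨ e-shift′ n (e-L n) (e-L (suc n)) (L n) ≤-refl ⟩
      F (6 + n) + e (L n)              ≡⟨ cong (F (6 + n) +_) (e-L n) ⟩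
      F (6 + n) + (F (5 + n) + e 0)    ≡⟨ +-assoc (F (6 + n)) (F (5 + n)) (e 0) ⟨
      F (7 + n) + e 0                  ∎
      where open ≡-Reasoning

    e-shift : ∀ n {k} → k ≤ L n → e (L (suc n) + k) ≡ F (6 + n) + e k
    e-shift n = e-shift′ n (e-L n) (e-L (suc n)) _

    gap-shift : ∀ n {k} → k < L n → gap k ≡ gap (L (suc n) + k)
    gap-shift n {k} k<L = begin
      e (suc k) ⊖ e k                                ≡⟨ +-cancelˡ-⊖ (F (6 + n)) (e (suc k)) (e k) ⟨
      (F (6 + n) + e (suc k)) ⊖ (F (6 + n) + e k)    ≡⟨ cong₂ _⊖_ (e-shift n k<L) (e-shift n (<⇒≤ k<L)) ⟨
      e (L (suc n) + suc k) ⊖ e (L (suc n) + k)      ≡⟨ cong (λ i → e i ⊖ e (L (suc n) + k)) (+-suc (L (suc n)) k) ⟩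
      gap (L (suc n) + k)                            ∎
      where open ≡-Reasoning

-- Words generated by morphisms

module _ {A : Set} where

  applyUpTo-+ : ∀ (f : ℕ → A) m n → applyUpTo f (m + n) ≡ applyUpTo f m ++ applyUpTo (f ∘ (m +_)) n
  applyUpTo-+ f zero    n = refl
  applyUpTo-+ f (suc m) n = cong (f 0 ∷_) (applyUpTo-+ (f ∘ suc) m n)

  applyUpTo-cong : ∀ {f g : ℕ → A} n → (∀ {i} → i < n → f i ≡ g i) → applyUpTo f n ≡ applyUpTo g n
  applyUpTo-cong zero    f≡g = refl
  applyUpTo-cong (suc n) f≡g = cong₂ _∷_ (f≡g z<s) (applyUpTo-cong n (f≡g ∘ s<s))

  applyUpTo-injective : ∀ {f g : ℕ → A} n → applyUpTo f n ≡ applyUpTo g n → ∀ {i} → i < n → f i ≡ g i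
  applyUpTo-injective (suc n) eq {zero}  _         = proj₁ (∷-injective eq)
  applyUpTo-injective (suc n) eq {suc i} (s≤s i<n) = applyUpTo-injective n (proj₂ (∷-injective eq)) i<n

  take-applyUpTo : ∀ (f : ℕ → A) {k n} → k ≤ n → take k (applyUpTo f n) ≡ applyUpTo f k
  take-applyUpTo f z≤n       = refl
  take-applyUpTo f (s≤s k≤n) = cong (f 0 ∷_) (take-applyUpTo (f ∘ suc) k≤n)

-- The recurrence of the powers may start only at an exponent `o`: for `μ-C` the second power is
-- 143, whereas the first followed by the zeroth is 141.
module Morphism {A : Set} (⟦_⟧ : A → ℤ) (letter : ℤ → A) (letter-⟦⟧ : ∀ x → letter ⟦ x ⟧ ≡ x)
                (μ : A → List A) (a : A) (prolongable : Prolongable μ a) (o : ℕ)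
                (power-rec : power μ (2 + o) a ≡ power μ (1 + o) a ++ power μ o a)
                (0<∣power₀∣ : 0 < length (power μ o a))
                (1<∣power₁∣ : 1 < length (power μ (1 + o) a)) where

  word : ℕ → List A
  word n = power μ (n + o) a

  -- `concatMap μ` respects concatenation, so one instance of the recurrence yields all later ones.
  word-rec : ∀ n → word (2 + n) ≡ word (1 + n) ++ word n
  word-rec zero    = power-rec
  word-rec (suc n) = trans (cong (concatMap μ) (word-rec n)) (concatMap-++ μ (word (1 + n)) (word n))

  L : ℕ → ℕ
  L n = length (word n)

  L-rec : ∀ n → L (2 + n) ≡ L (1 + n) + L n
  L-rec n = trans (cong length (word-rec n)) (length-++ (word (1 + n)))

  n<L : ∀ n → n < L n
  n<L zero          = 0<∣power₀∣
  n<L (suc zero)    = 1<∣power₁∣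
  n<L (suc (suc n)) = begin-strict
    2 + n            ≡⟨ +-comm 1 (1 + n) ⟩
    (1 + n) + 1      <⟨ +-mono-<-≤ (n<L (suc n)) (≤-trans (s≤s z≤n) (n<L n)) ⟩
    L (1 + n) + L n  ≡⟨ L-rec n ⟨
    L (2 + n)        ∎
    where open ≤-Reasoning

  isFixedPointOf : ∀ {V} → (∀ n → map ⟦_⟧ (word n) ≡ applyUpTo V (L n)) → IsFixedPointOf ⟦_⟧ μ V
  isFixedPointOf {V} V-word = w , (a , prolongable , limit) , V≡
    where
    w : ℕ → A
    -- Decoding `V` defines the limit word before `V` is known to stay in the alphabet; `V≡`
    -- establishes that afterwards.
    w = letter ∘ V

    word≡ : ∀ n → word n ≡ applyUpTo w (L n)
    word≡ n = begin
      word n                          ≡⟨ map-id (word n) ⟨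
      map id (word n)                 ≡⟨ map-cong letter-⟦⟧ (word n) ⟨
      map (letter ∘ ⟦_⟧) (word n)     ≡⟨ map-∘ (word n) ⟩
      map letter (map ⟦_⟧ (word n))   ≡⟨ cong (map letter) (V-word n) ⟩
      map letter (applyUpTo V (L n))  ≡⟨ map-applyUpTo V letter (L n) ⟩
      applyUpTo w (L n)               ∎
      where open ≡-Reasoning

    V≡ : ∀ n → V n ≡ ⟦ w n ⟧
    V≡ n = applyUpTo-injective (L n)
      (trans (sym (V-word n)) (trans (cong (map ⟦_⟧) (word≡ n)) (map-applyUpTo w ⟦_⟧ (L n))))
      (n<L n)

    limit : IsLimit (λ n → power μ n a) w
    -- For `n ≥ k + o` the power is `word (n ∸ o)`, whose length exceeds `n ∸ o ≥ k`.
    limit k = k + o , λ n k+o≤n →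
      let k≤n∸o = m+n≤o⇒m≤o∸n k k+o≤n in
      subst (λ m → take k (power μ m a) ≡ applyUpTo w k) (m∸n+n≡m (m+n≤o⇒n≤o k k+o≤n))
        (trans (cong (take k) (word≡ (n ∸ o)))
          (take-applyUpTo w (≤-trans k≤n∸o (<⇒≤ (n<L (n ∸ o))))))

  module Gaps {P : Pred ℕ 0ℓ} {e : ℕ → ℕ} (enum : IsIncreasingEnumeration P e) where

    open Enumeration enum using (gap; module Blocks)

    module _ (e-L₀ : e (L 0) ≡ F 5 + e 0) (e-L₁ : e (L 1) ≡ F 6 + e 0)
             (P-shift : ∀ n {j} → j ≤ F (5 + n) + e 0 → P j ⇔ P (F (6 + n) + j))
             (gaps₀ : map ⟦_⟧ (word 0) ≡ applyUpTo gap (L 0))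
             (gaps₁ : map ⟦_⟧ (word 1) ≡ applyUpTo gap (L 1)) where

      open Blocks L L-rec e-L₀ e-L₁ P-shift using (gap-shift)

      gaps : ∀ n → map ⟦_⟧ (word n) ≡ applyUpTo gap (L n)
      gaps zero          = gaps₀
      gaps (suc zero)    = gaps₁
      gaps (suc (suc n)) = begin
        map ⟦_⟧ (word (2 + n))
          ≡⟨ cong (map ⟦_⟧) (word-rec n) ⟩
        map ⟦_⟧ (word (1 + n) ++ word n)
          ≡⟨ map-++ ⟦_⟧ (word (1 + n)) (word n) ⟩
        map ⟦_⟧ (word (1 + n)) ++ map ⟦_⟧ (word n)
          ≡⟨ cong₂ _++_ (gaps (suc n)) (gaps n) ⟩
        applyUpTo gap (L (1 + n)) ++ applyUpTo gap (L n)
          ≡⟨ cong (applyUpTo gap (L (1 + n)) ++_) (applyUpTo-cong (L n) (gap-shift n)) ⟩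
        applyUpTo gap (L (1 + n)) ++ applyUpTo (gap ∘ (L (1 + n) +_)) (L n)
          ≡⟨ applyUpTo-+ gap (L (1 + n)) (L n) ⟨
        applyUpTo gap (L (1 + n) + L n)
          ≡⟨ cong (applyUpTo gap) (L-rec n) ⟨
        applyUpTo gap (L (2 + n)) ∎
        where open ≡-Reasoning

      isFixedPointOf-Δ : ∀ {V} → (∀ n → V n ≡ gap n) → IsFixedPointOf ⟦_⟧ μ V
      isFixedPointOf-Δ V≡gap = isFixedPointOf λ n →
        trans (gaps n) (applyUpTo-cong (L n) (λ {i} _ → sym (V≡gap i)))

-- Points of increase, constancy and decrease

letter-I : ℤ → Alphabet-I
letter-I (ℤ.+ 2) = 𝟐
letter-I _       = 𝟑

letter-I-⟦⟧ : ∀ x → letter-I ⟦ x ⟧I ≡ x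
letter-I-⟦⟧ 𝟐 = refl
letter-I-⟦⟧ 𝟑 = refl

letter-C : ℤ → Alphabet-C
letter-C (ℤ.+ 1) = 𝟏
letter-C (ℤ.+ 3) = 𝟑
letter-C _       = 𝟒

letter-C-⟦⟧ : ∀ x → letter-C ⟦ x ⟧C ≡ x
letter-C-⟦⟧ 𝟏 = refl
letter-C-⟦⟧ 𝟑 = refl
letter-C-⟦⟧ 𝟒 = refl

letter-D : ℤ → Alphabet-D
letter-D (ℤ.+ 3) = 𝟑
letter-D _       = 𝟓

letter-D-⟦⟧ : ∀ x → letter-D ⟦ x ⟧D ≡ x
letter-D-⟦⟧ 𝟑 = refl
letter-D-⟦⟧ 𝟓 = refl

ΔI_Z-fixed : IsFixedPointOf ⟦_⟧I μ-I (Δ I_Z)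
-- With `o = 1` the first words are 32 and 323. The four `refl` evaluate the enumeration: `e 2` is
-- 5, `e 3` is 8, and the gaps are 3, 2, 3.
ΔI_Z-fixed = isFixedPointOf-Δ refl refl
  (λ n {j} j≤ → Inc.trend-shift n {j} (m≤n⇒m≤1+n (subst (j ≤_) (+-identityʳ (F (5 + n))) j≤)))
  refl refl (λ n → m-n≡m⊖n (e (suc n)) (e n))
  where
  e : ℕ → ℕ
  e = enumerate increase? increase-unbounded
  open Morphism ⟦_⟧I letter-I letter-I-⟦⟧ μ-I 𝟑 (𝟐 , [] , refl) 1
    refl (s≤s z≤n) (s≤s (s≤s z≤n))
  open Gaps (enumerate-isIncreasingEnumeration increase? increase-unbounded)

ΔC_Z-fixed : IsFixedPointOf ⟦_⟧C μ-C (Δ C_Z)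
ΔC_Z-fixed = isFixedPointOf-Δ refl refl
  -- The first point of constancy is 1, so the range of `trend-shift` is used up to its end F(5+n) +
  -- 1.
  (λ n {j} j≤ → Const.trend-shift n {j} (subst (j ≤_) (+-comm (F (5 + n)) 1) j≤))
  refl refl (λ n → m-n≡m⊖n (e (suc n)) (e n))
  where
  e : ℕ → ℕ
  e = enumerate constancy? constancy-unbounded
  open Morphism ⟦_⟧C letter-C letter-C-⟦⟧ μ-C 𝟏 (𝟒 , [] , refl) 1
    refl (s≤s z≤n) (s≤s (s≤s z≤n))
  open Gaps (enumerate-isIncreasingEnumeration constancy? constancy-unbounded)

-- Moving all points up by 1 turns the initial -1 into 0, which keeps the enumeration in `ℕ` and
-- leaves the gaps unchanged.
AfterDecrease : Pred ℕ 0ℓ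
AfterDecrease zero    = ⊤
AfterDecrease (suc N) = Decrease N

1+D_Z : ℕ → ℕ
1+D_Z zero    = 0
1+D_Z (suc n) = suc (enumerate decrease? decrease-unbounded n)

1+D_Z-isIncreasingEnumeration : IsIncreasingEnumeration AfterDecrease 1+D_Z
1+D_Z-isIncreasingEnumeration = record
  { increasing = λ { zero → z<s ; (suc n) → s≤s (increasing n) }
  ; sound      = λ { zero → tt ; (suc n) → sound n }
  ; complete   = λ { zero _ → 0 , refl ; (suc N) d → complete-suc (complete N d) }
  }
  where
  open IsIncreasingEnumeration (enumerate-isIncreasingEnumeration decrease? decrease-unbounded)
  complete-suc : ∀ {N} → ∃[ n ] enumerate decrease? decrease-unbounded n ≡ N →
                 ∃[ n ] 1+D_Z n ≡ suc N
  complete-suc (n , eq) = suc n , cong suc eq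

-- The adjoined point 0 is translated to F(6+n), which must therefore follow a genuine decrease.
afterDecrease-F : ∀ n → AfterDecrease (F (5 + n))
afterDecrease-F n with 1<s_Z-pred-F n
... | j , j+1≡F , 1<s = subst AfterDecrease j+1≡F
  (subst (_< s_Z j) (sym (trans (cong s_Z j+1≡F) (s_Z-F (2 + n)))) 1<s)

afterDecrease-shift : ∀ n {j} → j ≤ F (5 + n) → AfterDecrease j ⇔ AfterDecrease (F (6 + n) + j)
afterDecrease-shift n {zero}  _ = mk⇔
  (λ _ → subst AfterDecrease (sym (+-identityʳ (F (6 + n)))) (afterDecrease-F (suc n)))
  (λ _ → tt)
afterDecrease-shift n {suc j} j<F =
  subst (λ k → Decrease j ⇔ AfterDecrease k) (sym (+-suc (F (6 + n)) j))
    (Dec.trend-shift n {j} (m≤n⇒m≤1+n (<⇒≤ j<F)))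

ΔD_Z-fixed : IsFixedPointOf ⟦_⟧D μ-D (Δ D_Z)
ΔD_Z-fixed = isFixedPointOf-Δ refl refl
  (λ n {j} j≤ → afterDecrease-shift n {j} (subst (j ≤_) (+-identityʳ (F (5 + n))) j≤))
  refl refl ΔD_Z≡
  where
  -- Here `o = 0`, since the words 5 and 53 already reach 5 = F(5) and 8 = F(6).
  open Morphism ⟦_⟧D letter-D letter-D-⟦⟧ μ-D 𝟓 (𝟑 , [] , refl) 0
    refl (s≤s z≤n) (s≤s (s≤s z≤n))
  open Gaps 1+D_Z-isIncreasingEnumeration
  ΔD_Z≡ : ∀ n → Δ D_Z n ≡ 1+D_Z (suc n) ⊖ 1+D_Z n
  -- Subtracting `D_Z 0`, which is -1, adds 1 to the first point of decrease.
  ΔD_Z≡ zero    = cong ℤ.+_ (+-comm _ 1)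
  ΔD_Z≡ (suc n) = trans (m-n≡m⊖n (d (suc n)) (d n)) (sym ([1+m]⊖[1+n]≡m⊖n (d (suc n)) (d n)))
    where
    d : ℕ → ℕ
    d = enumerate decrease? decrease-unbounded

theorem3 : (I_Z 0 ≡ 0ℤ × IsFixedPointOf ⟦_⟧I μ-I (Δ I_Z)) ×
    (C_Z 0 ≡ 1ℤ × IsFixedPointOf ⟦_⟧C μ-C (Δ C_Z)) ×
    (D_Z 0 ≡ -1ℤ × IsFixedPointOf ⟦_⟧D μ-D (Δ D_Z))
theorem3 = (refl , ΔI_Z-fixed) , (refl , ΔC_Z-fixed) , (refl , ΔD_Z-fixed)
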